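{- Let $G$ be a connected unicyclic graph. Suppose that a trimmed form $\breve{G}$ of $G$ is obtained from $G$ by a sequence of $n_1$ deletions of appropriate vertices, $n_2$ deletions of isolated paths, and $n_3$ deletions of peripheral leaves. Then: (i) if $\breve{G}$ is a partial sun, obtained from a cycle $C$ by appending one leaf to each vertex of a set $U\subseteq V(C)$, then ${\rm gp}(G)\geq \max\{2,|U|\}+n_2-n_1$; (ii) if $\breve{G}$ is the empty graph, then $n_2-n_1\leq \ell(G)$, where $\ell(G)$ is the number of pendent vertices (vertices of degree $1$) of $G$.
   Context: All graphs are finite and simple; a unicyclic graph is a connected graph with as many edges as vertices. A vertex $x$ of a graph $H$ is appropriate if $H-x$ has at least two connected components that are paths, each joined to $x$ in $H$ at only one of its endpoints. A vertex $x$ is a peripheral leaf if $x$ is adjacent to exactly one other vertex $y$ and $y$ has at most two neighbors. Deleting an appropriate vertex means removing that vertex; deleting an isolated path means removing a connected component that is a path; deleting a peripheral leaf means removing that vertex. The trimmed form $\breve{G}$ of $G$ is the induced subgraph obtained from $G$ by a sequence of such deletions performed until no further such deletion is possible (it is unique, and for unicyclic $G$ it is either the empty graph or a partial sun). A partial sun is a graph obtained from a cycle $C_n$ by appending one pendent vertex (leaf) to each vertex of some subset $U\subseteq V(C_n)$. A set $R\subseteq V(G)$ is a general position set if no three vertices of $R$ lie on a common shortest path of $G$; ${\rm gp}(G)$ is the maximum size of a general position set of $G$. -}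

module Defs where

open import Data.Bool using (Bool; true; false; _∧_)
open import Data.Nat using (ℕ; zero; suc; _+_; _≤_; _%_; _<ᵇ_; _≡ᵇ_)
open import Data.Fin using (Fin; zero; suc; toℕ; fromℕ)
open import Data.Fin.Subset using (Subset; _∈_; _∉_; _⊆_; _∩_; _─_; _-_; ∣_∣; ⊤; ⊥)
open import Data.Vec using (Vec; tabulate; sum)
open import Data.List using (List; []; _∷_; length)
open import Data.List.Membership.Propositional using () renaming (_∈_ to _∈ₗ_)
open import Data.Product using (Σ; ∃; ∃-syntax; _×_; _,_)
open import Data.Sum using (_⊎_)
open import Relation.Binary.PropositionalEquality using (_≡_; _≢_)
open import Relation.Nullary using (¬_)
open import Function.Bundles using (_⇔_)

record Graph (n : ℕ) : Set where
  field
    adj     : Fin n → Fin n → Bool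
    adj-sym : ∀ u v → adj u v ≡ adj v u
    adj-irr : ∀ v → adj v v ≡ false
open Graph public

module _ {n : ℕ} (G : Graph n) where

  Adj : Fin n → Fin n → Set
  Adj u v = adj G u v ≡ true

  N : Fin n → Subset n
  N v = tabulate (adj G v)

  deg : Fin n → ℕ
  deg v = ∣ N v ∣

  degIn : Subset n → Fin n → ℕ
  degIn S v = ∣ S ∩ N v ∣

  edgeCount : ℕ
  edgeCount = sum (tabulate (λ i → ∣ tabulate (λ j → (toℕ i <ᵇ toℕ j) ∧ adj G i j) ∣))

  pendent : ℕ
  pendent = ∣ tabulate (λ v → deg v ≡ᵇ 1) ∣

  data Reach (S : Subset n) : Fin n → Fin n → Set where
    here  : ∀ {v} → v ∈ S → Reach S v v
    there : ∀ {u w v} → u ∈ S → Adj u w → Reach S w v → Reach S u v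

  Connected : Set
  Connected = 1 ≤ n × (∀ u v → Reach ⊤ u v)

  Unicyclic : Set
  Unicyclic = Connected × edgeCount ≡ n

  IsComponent : Subset n → Subset n → Set
  IsComponent S C = ∃[ c ] (c ∈ S × (∀ v → (v ∈ C ⇔ Reach S c v)))

  PathEnum : Subset n → (k : ℕ) → (Fin (suc k) → Fin n) → Set
  PathEnum C k p =
      (∀ i j → p i ≡ p j → i ≡ j)
    × (∀ v → (v ∈ C ⇔ (∃[ i ] p i ≡ v)))
    × (∀ i j → (Adj (p i) (p j) ⇔ (toℕ j ≡ suc (toℕ i) ⊎ toℕ i ≡ suc (toℕ j))))

  IsPath : Subset n → Set
  IsPath C = ∃[ k ] ∃[ p ] PathEnum C k p

  PendentPathAt : Fin n → Subset n → Set
  PendentPathAt x C = ∃[ k ] ∃[ p ] (PathEnum C k p × Adj x (p zero)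
                        × (∀ v → v ∈ C → Adj x v → v ≡ p zero))

  Appropriate : Subset n → Fin n → Set
  Appropriate S x = x ∈ S × ∃[ C₁ ] ∃[ C₂ ] (C₁ ≢ C₂
      × IsComponent (S - x) C₁ × PendentPathAt x C₁
      × IsComponent (S - x) C₂ × PendentPathAt x C₂)

  IsolatedPath : Subset n → Subset n → Set
  IsolatedPath S C = IsComponent S C × IsPath C

  PeripheralLeaf : Subset n → Fin n → Set
  PeripheralLeaf S x = x ∈ S × ∃[ y ] (y ∈ S × Adj x y
      × (∀ z → z ∈ S → Adj x z → z ≡ y) × degIn S y ≤ 2)

  data Trim : Subset n → Subset n → ℕ → ℕ → ℕ → Set where
    done    : ∀ {S} → Trim S S 0 0 0
    delApp  : ∀ {S T a b c} x → Appropriate S x → Trim (S - x) T a b c → Trim S T (suc a) b c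
    delPath : ∀ {S T a b c} C → IsolatedPath S C → Trim (S ─ C) T a b c → Trim S T a (suc b) c
    delLeaf : ∀ {S T a b c} x → PeripheralLeaf S x → Trim (S - x) T a b c → Trim S T a b (suc c)

  Stuck : Subset n → Set
  Stuck S = (¬ (∃[ x ] Appropriate S x)) × (¬ (∃[ C ] IsolatedPath S C)) × (¬ (∃[ x ] PeripheralLeaf S x))

  SunEdge : (k : ℕ) → (Fin (3 + k) → Fin n) → Subset (3 + k) → (Fin (3 + k) → Fin n)
            → Fin n → Fin n → Set
  SunEdge k cyc U leaf v w =
      (∃[ i ] ∃[ j ] (toℕ j ≡ suc (toℕ i) % (3 + k)
         × ((cyc i ≡ v × cyc j ≡ w) ⊎ (cyc i ≡ w × cyc j ≡ v))))
    ⊎ (∃[ i ] (i ∈ U × ((cyc i ≡ v × leaf i ≡ w) ⊎ (cyc i ≡ w × leaf i ≡ v))))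

  record PartialSun (S : Subset n) : Set where
    field
      k        : ℕ
      cyc      : Fin (3 + k) → Fin n
      U        : Subset (3 + k)
      leaf     : Fin (3 + k) → Fin n
      cyc-inj  : ∀ i j → cyc i ≡ cyc j → i ≡ j
      leaf-inj : ∀ i j → i ∈ U → j ∈ U → leaf i ≡ leaf j → i ≡ j
      leaf-new : ∀ i j → i ∈ U → leaf i ≢ cyc j
      vertices : ∀ v → (v ∈ S ⇔ ((∃[ i ] cyc i ≡ v) ⊎ (∃[ i ] (i ∈ U × leaf i ≡ v))))
      edges    : ∀ v w → v ∈ S → w ∈ S → (Adj v w ⇔ SunEdge k cyc U leaf v w)

  data Walk : Fin n → Fin n → Set where
    [_]  : ∀ v → Walk v v
    cons : ∀ {w v} u → Adj u w → Walk w v → Walk u v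

  walkVertices : ∀ {u v} → Walk u v → List (Fin n)
  walkVertices [ v ]        = v ∷ []
  walkVertices (cons u _ W) = u ∷ walkVertices W

  walkLength : ∀ {u v} → Walk u v → ℕ
  walkLength [ v ]        = 0
  walkLength (cons u _ W) = suc (walkLength W)

  IsShortest : ∀ {u v} → Walk u v → Set
  IsShortest {u} {v} W = ∀ (W' : Walk u v) → walkLength W ≤ walkLength W'

  OnCommonShortestPath : Fin n → Fin n → Fin n → Set
  OnCommonShortestPath x y z = ∃[ u ] ∃[ v ] Σ (Walk u v) λ W →
    IsShortest W × x ∈ₗ walkVertices W × y ∈ₗ walkVertices W × z ∈ₗ walkVertices W

  GeneralPosition : Subset n → Set
  GeneralPosition R = ∀ x y z → x ∈ R → y ∈ R → z ∈ R →
    x ≢ y → y ≢ z → x ≢ z → ¬ OnCommonShortestPath x y z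

  IsGpNumber : ℕ → Set
  IsGpNumber g = (∃[ R ] (GeneralPosition R × ∣ R ∣ ≡ g))
               × (∀ R → GeneralPosition R → ∣ R ∣ ≤ g)

module Submission where

-- Give v ∈ S the weight |deg_S v - 2|, or 2 - deg_S v if v lies on the cycle C of the partial sun, and let
-- the potential of S be the sum of the weights. Deleting a vertex of degree d and weight w changes the
-- potential by at most d - w. So the potential rises by at most 2 for an appropriate vertex, does not rise
-- for a peripheral leaf, and drops by at least 2 for an isolated path. It is nonnegative on the trimmed form,
-- and by the handshake lemma it equals 2ℓ(G) - 2m on G, where m is the sum of deg c - 2 over c ∈ C.
-- Hence n₂ - n₁ ≤ ℓ(G) - m; for the empty trimmed form take C empty and m = 0.
-- For a partial sun it remains to bound max {2, |U|} + ℓ(G) by gp(G) + m. The leaves of G are in general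
-- position and |U| ≤ m, so only the bound with 2 needs care. If two vertices of C have degree ≥ 3, then m ≥ 2.
-- If there is exactly one, every walk into C passes through it, so another vertex of C can be added to the
-- leaves. If there is none, then G has no leaves, and any two vertices are in general position.

open import Defs
open import Data.Bool using (Bool; true; false; _∧_; if_then_else_)
open import Data.Bool.Properties using (¬-not; T-≡)
open import Data.Nat as ℕ using (ℕ; zero; suc; _⊔_; z≤n; s≤s; _%_; _<ᵇ_; _≡ᵇ_)
import Data.Nat.Properties as ℕ
open import Data.Nat.DivMod using (m<n⇒m%n≡m; n%n≡0)
open import Data.Integer using (ℤ; +_; _+_; _-_; -_; _*_; _≤_; 0ℤ; 1ℤ; +≤+)
import Data.Integer.Properties as ℤ
open import Data.Integer.Tactic.RingSolver using (solve-∀)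
open import Data.Fin using (Fin; zero; suc; toℕ; fromℕ; inject₁; _≟_)
import Data.Fin.Properties as Fin
open import Data.Fin.Relation.Unary.Top using (view; ‵fromℕ; ‵inject₁; view-fromℕ; view-inject₁)
open import Data.Fin.Subset as Subset using (Subset; _∈_; _∉_; _⊆_; _─_; _∪_; ⁅_⁆; ⊤; ⊥; ∣_∣)
import Data.Fin.Subset.Properties as Subset
open import Data.Vec as Vec using ([]; _∷_; lookup; tabulate)
open import Data.Vec.Properties using ([]=⇒lookup; lookup⇒[]=; lookup-zipWith; lookup∘tabulate; lookup-replicate)
open import Data.List using (List; []; _∷_; length)
open import Data.List.Membership.Propositional using () renaming (_∈_ to _∈ₗ_)
open import Data.List.Relation.Unary.Any using (here; there)
open import Data.List.Relation.Unary.All as All using (All; []; _∷_)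
open import Data.List.Relation.Unary.AllPairs using ([]; _∷_)
open import Data.List.Relation.Unary.Unique.Propositional using (Unique)
open import Data.Product using (∃-syntax; _×_; _,_; proj₁; proj₂)
open import Data.Sum using (_⊎_; inj₁; inj₂; swap)
open import Function using (_∘_)
open import Function.Bundles using (Equivalence)
open import Relation.Binary.PropositionalEquality
  using (_≡_; _≢_; refl; sym; trans; cong; cong₂; subst; subst₂)
open import Relation.Nullary using (¬_; Dec; yes; no; does; contradiction; ¬?; _×-dec_)
open import Relation.Nullary.Decidable using (dec-true)
open import Algebra.Properties.AbelianGroup ℤ.+-0-abelianGroup using (∙-cancelʳ)
open import Algebra.Properties.CommutativeMonoid.Sum ℤ.+-0-commutativeMonoid
  using (sum; sum-cong-≗; ∑-distrib-+; ∑-comm)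

open Equivalence using (to; from)

-- Integer inequalities and sums over `Fin n`

≤-by-difference : ∀ {i j k} → 0ℤ ≤ k → j - i ≡ k → i ≤ j
≤-by-difference 0≤k eq = ℤ.0≤i-j⇒j≤i (subst (0ℤ ≤_) (sym eq) 0≤k)

0≤+ : ∀ {i j} → 0ℤ ≤ i → 0ℤ ≤ j → 0ℤ ≤ i + j
0≤+ = ℤ.+-mono-≤

⟦_⟧ : Bool → ℤ
⟦ true  ⟧ = 1ℤ
⟦ false ⟧ = 0ℤ

0≤⟦_⟧ : ∀ b → 0ℤ ≤ ⟦ b ⟧
0≤⟦ true  ⟧ = +≤+ z≤n
0≤⟦ false ⟧ = +≤+ z≤n

sum-mono : ∀ {n} {f g : Fin n → ℤ} → (∀ i → f i ≤ g i) → sum f ≤ sum g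
sum-mono {zero}  f≤g = ℤ.≤-refl
sum-mono {suc n} f≤g = ℤ.+-mono-≤ (f≤g zero) (sum-mono (f≤g ∘ suc))

sum-zero : ∀ n → sum {n} (λ _ → 0ℤ) ≡ 0ℤ
sum-zero zero    = refl
sum-zero (suc n) = trans (ℤ.+-identityˡ _) (sum-zero n)

sum-one : ∀ n → sum {n} (λ _ → 1ℤ) ≡ + n
sum-one zero    = refl
sum-one (suc n) = cong (λ s → 1ℤ + s) (sum-one n)

∣∣-sum : ∀ {n} (p : Subset n) → + ∣ p ∣ ≡ sum (λ i → ⟦ lookup p i ⟧)
∣∣-sum []          = refl
∣∣-sum (true  ∷ p) = cong (λ s → 1ℤ + s) (∣∣-sum p)
∣∣-sum (false ∷ p) = trans (∣∣-sum p) (sym (ℤ.+-identityˡ _))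

-- A point mass: it lets a quantity attached to one vertex take part in a termwise comparison of
-- sums.
at : ∀ {n} → Fin n → ℤ → Fin n → ℤ
at x c v = if does (v ≟ x) then c else 0ℤ

at-self : ∀ {n} (x : Fin n) c → at x c x ≡ c
at-self x c with x ≟ x
... | yes _  = refl
... | no x≢x = contradiction refl x≢x

at-other : ∀ {n} {x v : Fin n} {c} → v ≢ x → at x c v ≡ 0ℤ
at-other {x = x} {v} v≢x with v ≟ x
... | yes v≡x = contradiction v≡x v≢x
... | no _    = refl

0≤at : ∀ {n} (x : Fin n) {c} v → 0ℤ ≤ c → 0ℤ ≤ at x c v
0≤at x v 0≤c with does (v ≟ x)
... | true  = 0≤c
... | false = ℤ.≤-refl

sum-at : ∀ {n} (x : Fin n) c → sum (at x c) ≡ c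
sum-at {suc n} zero    c = trans (cong (λ s → c + s) (sum-zero n)) (ℤ.+-identityʳ c)
sum-at {suc n} (suc x) c = trans (ℤ.+-identityˡ _) (sum-at x c)

-- The multiplicity function of the list, through which a length becomes a sum over `Fin n`.
marks : ∀ {n} → List (Fin n) → Fin n → ℤ
marks []       v = 0ℤ
marks (x ∷ xs) v = at x 1ℤ v + marks xs v

sum-marks : ∀ {n} (xs : List (Fin n)) → sum (marks xs) ≡ + length xs
sum-marks {n} []   = sum-zero n
sum-marks (x ∷ xs) = trans (∑-distrib-+ (at x 1ℤ) (marks xs)) (cong₂ _+_ (sum-at x 1ℤ) (sum-marks xs))

0≤marks : ∀ {n} (xs : List (Fin n)) v → 0ℤ ≤ marks xs v
0≤marks []       v = ℤ.≤-refl
0≤marks (x ∷ xs) v = 0≤+ (0≤at x v (+≤+ z≤n)) (0≤marks xs v)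

1≤marks : ∀ {n} {xs : List (Fin n)} {v} → v ∈ₗ xs → 1ℤ ≤ marks xs v
1≤marks {xs = x ∷ xs} (here refl) rewrite at-self x 1ℤ = ℤ.+-monoʳ-≤ 1ℤ (0≤marks xs x)
1≤marks {xs = x ∷ xs} {v} (there v∈xs) = ℤ.+-mono-≤ (0≤at x v (+≤+ z≤n)) (1≤marks v∈xs)

marks≡0 : ∀ {n} {xs : List (Fin n)} {v} → All (v ≢_) xs → marks xs v ≡ 0ℤ
marks≡0 []            = refl
marks≡0 (v≢x ∷ v∉xs) = cong₂ _+_ (at-other v≢x) (marks≡0 v∉xs)

-- Distinct entries have multiplicity at most 1, so `marks xs` stays below `f` at every point.
length-≤-sum : ∀ {n} {xs : List (Fin n)} {f : Fin n → ℤ} → Unique xs →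
               (∀ v → 0ℤ ≤ f v) → All (λ x → 1ℤ ≤ f x) xs → + length xs ≤ sum f
length-≤-sum {n} {xs} {f} unique 0≤f 1≤f =
  subst (_≤ sum f) (sum-marks xs) (sum-mono (λ v → marks≤ unique 1≤f v))
  where
  marks≤ : ∀ {ys} → Unique ys → All (λ x → 1ℤ ≤ f x) ys → ∀ v → marks ys v ≤ f v
  marks≤ [] [] v = 0≤f v
  marks≤ {y ∷ ys} (y∉ys ∷ unique) (1≤fy ∷ 1≤f) v with v ≟ y
  ... | yes refl rewrite marks≡0 y∉ys = 1≤fy
  ... | no _     rewrite ℤ.+-identityˡ (marks ys v) = marks≤ unique 1≤f v

-- Subsets as Boolean vectors

∉⇒lookup : ∀ {n} {p : Subset n} {v} → v ∉ p → lookup p v ≡ false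
∉⇒lookup {p = p} {v} v∉p = ¬-not (v∉p ∘ lookup⇒[]= v p)

lookup-─-∈ : ∀ {n} (p q : Subset n) {v} → v ∈ q → lookup (p ─ q) v ≡ false
lookup-─-∈ (_ ∷ p) (true ∷ q) {zero}  _ = refl
lookup-─-∈ (_ ∷ p) (false ∷ q) {zero} ()
lookup-─-∈ (_ ∷ p) (_ ∷ q)    {suc v} v∈q = lookup-─-∈ p q (Subset.drop-there v∈q)

lookup-─-∉ : ∀ {n} (p q : Subset n) {v} → v ∉ q → lookup (p ─ q) v ≡ lookup p v
lookup-─-∉ (_ ∷ p) (true  ∷ q) {zero}  v∉q = contradiction Vec.here v∉q
lookup-─-∉ (_ ∷ p) (false ∷ q) {zero}  v∉q = refl
lookup-─-∉ (_ ∷ p) (_ ∷ q)     {suc v} v∉q = lookup-─-∉ p q (Subset.drop-not-there v∉q)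

lookup-minus-self : ∀ {n} (p : Subset n) x → lookup (p Subset.- x) x ≡ false
lookup-minus-self p x = lookup-─-∈ p ⁅ x ⁆ (Subset.x∈⁅x⁆ x)

lookup-minus-other : ∀ {n} (p : Subset n) {x v} → v ≢ x → lookup (p Subset.- x) v ≡ lookup p v
lookup-minus-other p v≢x = lookup-─-∉ p _ (Subset.x≢y⇒x∉⁅y⁆ v≢x)

∉-minus : ∀ {n} (p : Subset n) x → x ∉ p Subset.- x
∉-minus p x x∈ with () ← trans (sym ([]=⇒lookup x∈)) (lookup-minus-self p x)

lookup-injective : ∀ {n} (p q : Subset n) → (∀ v → lookup p v ≡ lookup q v) → p ≡ q
lookup-injective []      []      eq = refl
lookup-injective (_ ∷ p) (_ ∷ q) eq = cong₂ _∷_ (eq zero) (lookup-injective p q (eq ∘ suc))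

-- Degrees in induced subgraphs

module _ {n : ℕ} (G : Graph n) where

  degIn-sum : ∀ S v → + degIn G S v ≡ sum (λ w → ⟦ lookup S w ∧ adj G v w ⟧)
  degIn-sum S v = trans (∣∣-sum (S Subset.∩ N G v)) (sum-cong-≗ λ w →
    cong ⟦_⟧ (trans (lookup-zipWith _∧_ w S (N G v))
                    (cong (lookup S w ∧_) (lookup∘tabulate (adj G v) w))))

  deg-sum : ∀ v → + deg G v ≡ sum (λ w → ⟦ adj G v w ⟧)
  deg-sum v = trans (∣∣-sum (N G v)) (sum-cong-≗ λ w → cong ⟦_⟧ (lookup∘tabulate (adj G v) w))

  degIn-⊤ : ∀ v → degIn G ⊤ v ≡ deg G v
  degIn-⊤ v = cong ∣_∣ (Subset.∩-identityˡ (N G v))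

  degIn-≤-length : ∀ {S v} xs → (∀ w → w ∈ S → Adj G v w → w ∈ₗ xs) → + degIn G S v ≤ + length xs
  degIn-≤-length {S} {v} xs nbr = subst₂ _≤_ (sym (degIn-sum S v)) (sum-marks xs) (sum-mono pointwise)
    where
    pointwise : ∀ w → ⟦ lookup S w ∧ adj G v w ⟧ ≤ marks xs w
    pointwise w with lookup S w in w∈S | adj G v w in vw
    ... | true  | true  = 1≤marks (nbr w (lookup⇒[]= w S w∈S) vw)
    ... | true  | false = 0≤marks xs w
    ... | false | _     = 0≤marks xs w

  length-≤-deg : ∀ {v xs} → Unique xs → All (Adj G v) xs → + length xs ≤ + deg G v
  length-≤-deg {v} unique nbrs = subst (_ ≤_) (sym (deg-sum v))
    (length-≤-sum unique (λ w → 0≤⟦ adj G v w ⟧)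
      (All.map (λ vw → ℤ.≤-reflexive (cong ⟦_⟧ (sym vw))) nbrs))

  degIn-minus : ∀ {S x} v → x ∈ S →
                + degIn G S v ≡ ⟦ adj G v x ⟧ + + degIn G (S Subset.- x) v
  degIn-minus {S} {x} v x∈S =
    trans (degIn-sum S v)
      (trans (sum-cong-≗ pointwise)
        (trans (∑-distrib-+ (at x ⟦ adj G v x ⟧) _)
          (cong₂ _+_ (sum-at x ⟦ adj G v x ⟧) (sym (degIn-sum (S Subset.- x) v)))))
    where
    pointwise : ∀ w → ⟦ lookup S w ∧ adj G v w ⟧
                      ≡ at x ⟦ adj G v x ⟧ w + ⟦ lookup (S Subset.- x) w ∧ adj G v w ⟧
    pointwise w with w ≟ x
    ... | yes refl rewrite []=⇒lookup x∈S | lookup-minus-self S x = sym (ℤ.+-identityʳ _)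
    ... | no w≢x   rewrite lookup-minus-other S w≢x = sym (ℤ.+-identityˡ _)

-- |d - 2|
defect : ℕ → ℕ
defect 0             = 2
defect 1             = 1
defect (suc (suc d)) = d

-- `true` stands for a vertex of the cycle; there the weight is linear in the degree and may be
-- negative.
weight : Bool → ℕ → ℤ
weight true  d = + 2 - + d
weight false d = + defect d

-- The effect of a deletion on one neighbour of the deleted vertex: both versions of the weight are
-- 1-Lipschitz in the degree.
weight-suc : ∀ b d → weight b d ≤ weight b (suc d) + 1ℤ
weight-suc true d = ℤ.≤-reflexive (eq (+ d))
  where
  eq : ∀ z → + 2 - z ≡ + 2 - (1ℤ + z) + 1ℤ
  eq = solve-∀
weight-suc false 0             = +≤+ (s≤s (s≤s z≤n))
weight-suc false 1             = +≤+ (s≤s z≤n)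
weight-suc false (suc (suc d)) = +≤+ (ℕ.≤-trans (ℕ.n≤1+n d) (ℕ.m≤m+n (suc d) 1))

-- The estimate behind leaves and isolated vertices: w ≥ 2 - d turns the bound d - w into 2d - 2.
0≤weight+d-2 : ∀ b d → 0ℤ ≤ weight b d + + d - + 2
0≤weight+d-2 true d = ℤ.≤-reflexive (eq (+ d))
  where
  eq : ∀ z → 0ℤ ≡ + 2 - z + z - + 2
  eq = solve-∀
0≤weight+d-2 false 0             = +≤+ z≤n
0≤weight+d-2 false 1             = +≤+ z≤n
0≤weight+d-2 false (suc (suc d)) = ℤ.i≤j⇒0≤j-i (+≤+ (ℕ.m≤n⇒m≤o+n d (s≤s (s≤s z≤n))))

-- The estimate behind appropriate vertices: off the cycle w ≥ d - 2, hence d - w ≤ 2 for every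
-- degree.
0≤defect+2-d : ∀ d → 0ℤ ≤ + defect d + + 2 - + d
0≤defect+2-d 0             = +≤+ z≤n
0≤defect+2-d 1             = +≤+ z≤n
0≤defect+2-d (suc (suc d)) = ℤ.i≤j⇒0≤j-i (+≤+ (ℕ.≤-reflexive (ℕ.+-comm 2 d)))

-- The potential and its change under deletions

module Potential {n : ℕ} (G : Graph n) (C : Subset n) where

  charge : Subset n → Fin n → ℤ
  charge S v = if lookup S v then weight (lookup C v) (degIn G S v) else 0ℤ

  potential : Subset n → ℤ
  potential S = sum (charge S)

  -- The weight of `x` disappears, each neighbour of `x` in `S` gains at most 1, and all other
  -- weights stay the same; summing these termwise bounds gives the claim.
  potential-minus : ∀ {S x} → x ∈ S →
    potential (S Subset.- x) + weight (lookup C x) (degIn G S x) ≤ potential S + + degIn G S x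
  potential-minus {S} {x} x∈S =
    subst₂ _≤_
      (trans (∑-distrib-+ (charge (S Subset.- x)) (at x c))
             (cong (λ s → potential (S Subset.- x) + s) (sum-at x c)))
      (trans (∑-distrib-+ (charge S) (λ v → ⟦ lookup S v ∧ adj G x v ⟧))
             (cong (λ s → potential S + s) (sym (degIn-sum G S x))))
      (sum-mono pointwise)
    where
    c = weight (lookup C x) (degIn G S x)

    lipschitz : ∀ v → weight (lookup C v) (degIn G (S Subset.- x) v)
                      ≤ weight (lookup C v) (degIn G S v) + ⟦ adj G v x ⟧
    lipschitz v with adj G v x | degIn-minus G v x∈S
    ... | true  | eq rewrite ℤ.+-injective eq = weight-suc (lookup C v) _
    ... | false | eq rewrite ℤ.+-injective eq = ℤ.≤-reflexive (sym (ℤ.+-identityʳ _))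

    pointwise : ∀ v → charge (S Subset.- x) v + at x c v ≤ charge S v + ⟦ lookup S v ∧ adj G x v ⟧
    pointwise v with v ≟ x
    ... | yes refl rewrite lookup-minus-self S x | []=⇒lookup x∈S | adj-irr G x =
      ℤ.≤-reflexive (ℤ.+-comm 0ℤ c)
    ... | no v≢x rewrite lookup-minus-other S v≢x with lookup S v
    ...   | true  rewrite adj-sym G x v | ℤ.+-identityʳ (weight (lookup C v) (degIn G (S Subset.- x) v)) = lipschitz v
    ...   | false = ℤ.≤-refl

  potential-minus-leaf : ∀ {S x} → x ∈ S → + degIn G S x ≤ 1ℤ →
    potential (S Subset.- x) ≤ potential S
  potential-minus-leaf {S} {x} x∈S d≤1 = ≤-by-difference
    (0≤+ (0≤+ (ℤ.i≤j⇒0≤j-i (potential-minus x∈S)) (0≤weight+d-2 (lookup C x) (degIn G S x)))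
         -- The hypothesis on the degree d enters twice because the change is bounded by 2d - 2.
         (0≤+ (ℤ.i≤j⇒0≤j-i d≤1) (ℤ.i≤j⇒0≤j-i d≤1)))
    (eq (potential (S Subset.- x)) (potential S) (weight (lookup C x) (degIn G S x)) (+ degIn G S x))
    where
    eq : ∀ q p w d → p - q ≡ p + d - (q + w) + (w + d - + 2) + (1ℤ - d + (1ℤ - d))
    eq = solve-∀

  potential-minus-isolated : ∀ {S x} → x ∈ S → + degIn G S x ≤ 0ℤ →
    potential (S Subset.- x) + + 2 ≤ potential S
  potential-minus-isolated {S} {x} x∈S d≤0 = ≤-by-difference
    (0≤+ (0≤+ (ℤ.i≤j⇒0≤j-i (potential-minus x∈S)) (0≤weight+d-2 (lookup C x) (degIn G S x)))
         (0≤+ (ℤ.i≤j⇒0≤j-i d≤0) (ℤ.i≤j⇒0≤j-i d≤0)))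
    (eq (potential (S Subset.- x)) (potential S) (weight (lookup C x) (degIn G S x)) (+ degIn G S x))
    where
    eq : ∀ q p w d → p - (q + + 2) ≡ p + d - (q + w) + (w + d - + 2) + (0ℤ - d + (0ℤ - d))
    eq = solve-∀

  potential-minus-outside : ∀ {S x} → x ∈ S → x ∉ C →
    potential (S Subset.- x) ≤ potential S + + 2
  potential-minus-outside {S} {x} x∈S x∉C with removal ← potential-minus x∈S
    rewrite ∉⇒lookup x∉C = ≤-by-difference
    (0≤+ (ℤ.i≤j⇒0≤j-i removal) (0≤defect+2-d (degIn G S x)))
    (eq (potential (S Subset.- x)) (potential S) (+ defect (degIn G S x)) (+ degIn G S x))
    where
    eq : ∀ q p w d → p + + 2 - q ≡ p + d - (q + w) + (w + + 2 - d)
    eq = solve-∀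

  -- The path is removed vertex by vertex from its end p 0: all but the last removed vertex are leaves.
  potential-path : ∀ k (p : Fin (suc k) → Fin n) S → (∀ i j → p i ≡ p j → i ≡ j) →
    (∀ i → p i ∈ S) →
    (∀ i w → w ∈ S → Adj G (p i) w →
      ∃[ j ] (p j ≡ w × (toℕ j ≡ suc (toℕ i) ⊎ toℕ i ≡ suc (toℕ j)))) →
    ∃[ S′ ] ((∀ v → (∀ i → p i ≢ v) → lookup S′ v ≡ lookup S v)
           × (∀ i → lookup S′ (p i) ≡ false)
           × potential S′ + + 2 ≤ potential S)
  potential-path zero p S p-inj p∈S nbr =
    S Subset.- p zero
    , (λ v v≢p → lookup-minus-other S (v≢p zero ∘ sym))
    , (λ { zero → lookup-minus-self S (p zero) })
    , potential-minus-isolated (p∈S zero) (degIn-≤-length G [] (λ w w∈S pw → contradiction pw (none w w∈S)))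
    where
    none : ∀ w → w ∈ S → ¬ Adj G (p zero) w
    none w w∈S pw with nbr zero w w∈S pw
    ... | zero , _ , inj₁ ()
    ... | zero , _ , inj₂ ()
  potential-path (suc k) p S p-inj p∈S nbr =
    let S′ , same , gone , bound = potential-path k (p ∘ suc) (S Subset.- p zero)
          (λ i j eq → Fin.suc-injective (p-inj _ _ eq))
          (λ i → Subset.x∈p∧x≢y⇒x∈p-y (p∈S (suc i)) (p-suc≢p-zero i))
          nbr′
    in S′
     , (λ v v≢p → trans (same v (v≢p ∘ suc)) (lookup-minus-other S (v≢p zero ∘ sym)))
     , (λ { zero    → trans (same (p zero) p-suc≢p-zero) (lookup-minus-self S (p zero))
          ; (suc i) → gone i })
     , ℤ.≤-trans bound (potential-minus-leaf (p∈S zero) (degIn-≤-length G (p (suc zero) ∷ []) second))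
    where
    p-suc≢p-zero : ∀ i → p (suc i) ≢ p zero
    p-suc≢p-zero i eq with () ← p-inj _ _ eq

    second : ∀ w → w ∈ S → Adj G (p zero) w → w ∈ₗ p (suc zero) ∷ []
    second w w∈S pw with nbr zero w w∈S pw
    ... | j , refl , inj₁ eq = here (cong p (Fin.toℕ-injective eq))
    ... | j , refl , inj₂ ()

    nbr′ : ∀ i w → w ∈ S Subset.- p zero → Adj G (p (suc i)) w →
           ∃[ j ] (p (suc j) ≡ w × (toℕ j ≡ suc (toℕ i) ⊎ toℕ i ≡ suc (toℕ j)))
    nbr′ i w w∈ pw with nbr (suc i) w (Subset.p─q⊆p S _ w∈) pw
    ... | zero  , refl , _       = contradiction w∈ (∉-minus S (p zero))
    ... | suc j , pj≡w , inj₁ eq = j , pj≡w , inj₁ (ℕ.suc-injective eq)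
    ... | suc j , pj≡w , inj₂ eq = j , pj≡w , inj₂ (ℕ.suc-injective eq)

  -- As `P` is a component of `S`, a neighbour in `S` of a path vertex is again on the path, and
  -- then consecutive to it. This is the neighbourhood condition under which `potential-path`
  -- dismantles the path.
  potential-isolatedPath : ∀ {S P} → IsolatedPath G S P →
    potential (S ─ P) + + 2 ≤ potential S
  potential-isolatedPath {S} {P} ((c , _ , P⇔reach) , k , p , p-inj , P⇔p , adj⇔) =
    let S′ , same , gone , bound =
          potential-path k p S p-inj (λ i → reach⇒∈ (to (P⇔reach (p i)) (p∈P i))) nbr
    -- The set left by `potential-path` is known only through its lookups; extensionality identifies
    -- it with `S ─ P`.
    in subst (λ X → potential X + + 2 ≤ potential S)
         (lookup-injective S′ (S ─ P) (agree S′ same gone)) bound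
    where
    p∈P : ∀ i → p i ∈ P
    p∈P i = from (P⇔p (p i)) (i , refl)

    reach⇒∈ : ∀ {u v} → Reach G S u v → v ∈ S
    reach⇒∈ (here v∈S)    = v∈S
    reach⇒∈ (there _ _ r) = reach⇒∈ r

    reach-snoc : ∀ {u v w} → Reach G S u v → w ∈ S → Adj G v w → Reach G S u w
    reach-snoc (here v∈S)      w∈S vw = there v∈S vw (here w∈S)
    reach-snoc (there u∈S e r) w∈S vw = there u∈S e (reach-snoc r w∈S vw)

    nbr : ∀ i w → w ∈ S → Adj G (p i) w →
          ∃[ j ] (p j ≡ w × (toℕ j ≡ suc (toℕ i) ⊎ toℕ i ≡ suc (toℕ j)))
    nbr i w w∈S pw
      with to (P⇔p w) (from (P⇔reach w) (reach-snoc (to (P⇔reach (p i)) (p∈P i)) w∈S pw))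
    ... | j , refl = j , refl , to (adj⇔ i j) pw

    agree : ∀ S′ → (∀ v → (∀ i → p i ≢ v) → lookup S′ v ≡ lookup S v) →
            (∀ i → lookup S′ (p i) ≡ false) → ∀ v → lookup S′ v ≡ lookup (S ─ P) v
    agree S′ same gone v with v Subset.∈? P
    ... | no v∉P = trans (same v (λ i eq → v∉P (from (P⇔p v) (i , eq)))) (sym (lookup-─-∉ S P v∉P))
    ... | yes v∈P with i , refl ← to (P⇔p v) v∈P = trans (gone i) (sym (lookup-─-∈ S P v∈P))

  trim-⊆ : ∀ {S T a b c} → Trim G S T a b c → T ⊆ S
  trim-⊆ done            v∈T = v∈T
  trim-⊆ (delApp x _ t)  v∈T = Subset.p─q⊆p _ _ (trim-⊆ t v∈T)
  trim-⊆ (delPath P _ t) v∈T = Subset.p─q⊆p _ _ (trim-⊆ t v∈T)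
  trim-⊆ (delLeaf x _ t) v∈T = Subset.p─q⊆p _ _ (trim-⊆ t v∈T)

  -- Induction on the deletions: an appropriate vertex adds at most 2, an isolated path takes away
  -- at least 2, and a peripheral leaf adds nothing.
  potential-trim : ∀ {S T a b c} → C ⊆ T → Trim G S T a b c →
    potential T + (+ b + + b) ≤ potential S + (+ a + + a)
  potential-trim C⊆T done = ℤ.≤-refl
  potential-trim {S} {T} {suc a} {b} C⊆T (delApp x (x∈S , _) t) = ≤-by-difference
    (0≤+ (ℤ.i≤j⇒0≤j-i (potential-trim C⊆T t)) (ℤ.i≤j⇒0≤j-i
      -- `x` is off `C`: everything in `C` survives into `T`, hence lies in `S - x`.
      (potential-minus-outside x∈S (∉-minus _ x ∘ trim-⊆ t ∘ C⊆T))))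
    (eq (potential T) (potential S) (potential (S Subset.- x)) (+ a) (+ b))
    where
    eq : ∀ t s s′ a b → s + (1ℤ + a + (1ℤ + a)) - (t + (b + b))
                        ≡ s′ + (a + a) - (t + (b + b)) + (s + + 2 - s′)
    eq = solve-∀
  potential-trim {S} {T} {a} {suc b} C⊆T (delPath P path t) = ≤-by-difference
    (0≤+ (ℤ.i≤j⇒0≤j-i (potential-trim C⊆T t)) (ℤ.i≤j⇒0≤j-i (potential-isolatedPath path)))
    (eq (potential T) (potential S) (potential (S ─ P)) (+ a) (+ b))
    where
    eq : ∀ t s s′ a b → s + (a + a) - (t + (1ℤ + b + (1ℤ + b)))
                        ≡ s′ + (a + a) - (t + (b + b)) + (s - (s′ + + 2))
    eq = solve-∀
  potential-trim {S} {a = a} C⊆T (delLeaf x (x∈S , y , _ , _ , unique , _) t) =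
    ℤ.≤-trans (potential-trim C⊆T t)
      (ℤ.+-monoˡ-≤ (+ a + + a) (potential-minus-leaf x∈S (degIn-≤-length G (y ∷ []) (λ z z∈S xz → here (unique z z∈S xz)))))

-- The indicator of `U` pushed forward along `h`. With `leaf` and with `cyc` it gives two functions
-- of the same total `∣ U ∣`, one on the leaves of the sun and one on their supports.
spread : ∀ {m n} → (Fin m → Fin n) → Subset m → Fin n → ℤ
spread h U v = sum (λ i → at (h i) ⟦ lookup U i ⟧ v)

sum-spread : ∀ {m n} (h : Fin m → Fin n) U → sum (spread h U) ≡ + ∣ U ∣
sum-spread h U = trans (∑-comm (λ v i → at (h i) ⟦ lookup U i ⟧ v))
  (trans (sum-cong-≗ (λ i → sum-at (h i) ⟦ lookup U i ⟧)) (sym (∣∣-sum U)))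

spread-miss : ∀ {m n} (h : Fin m → Fin n) U {v} → (∀ i → i ∈ U → v ≢ h i) → spread h U v ≡ 0ℤ
spread-miss {m} h U {v} miss = trans (sum-cong-≗ pointwise) (sum-zero m)
  where
  pointwise : ∀ i → at (h i) ⟦ lookup U i ⟧ v ≡ 0ℤ
  pointwise i with v ≟ h i
  ... | no _ = refl
  ... | yes v≡hi = cong ⟦_⟧ (∉⇒lookup λ i∈U → miss i i∈U v≡hi)

-- Injectivity is required only against indices in `U`, since `leaf` is unconstrained elsewhere; a
-- collision outside `U` carries mass 0.
spread-hit : ∀ {m n} (h : Fin m → Fin n) U i → (∀ j → j ∈ U → h i ≡ h j → i ≡ j) →
             spread h U (h i) ≡ ⟦ lookup U i ⟧
spread-hit h U i inj = trans (sum-cong-≗ pointwise) (sum-at i ⟦ lookup U i ⟧)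
  where
  pointwise : ∀ j → at (h j) ⟦ lookup U j ⟧ (h i) ≡ at i ⟦ lookup U i ⟧ j
  pointwise j with j ≟ i
  ... | yes refl = at-self (h i) ⟦ lookup U i ⟧
  ... | no j≢i with h i ≟ h j
  ...   | no _      = refl
  ...   | yes hi≡hj = cong ⟦_⟧ (∉⇒lookup λ j∈U → j≢i (sym (inj j j∈U hi≡hj)))

-- The handshake lemma and pendent vertices

Vec-sum≡sum : ∀ {n} (f : Fin n → ℕ) → + Vec.sum (tabulate f) ≡ sum (λ i → + f i)
Vec-sum≡sum {zero}  f = refl
Vec-sum≡sum {suc n} f = cong (λ s → + f zero + s) (Vec-sum≡sum (f ∘ suc))

split-<ᵇ : ∀ a b {c} → (a ≡ b → c ≡ false) → ⟦ c ⟧ ≡ ⟦ (a <ᵇ b) ∧ c ⟧ + ⟦ (b <ᵇ a) ∧ c ⟧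
split-<ᵇ zero    zero    irr rewrite irr refl = refl
split-<ᵇ zero    (suc b) irr = sym (ℤ.+-identityʳ _)
split-<ᵇ (suc a) zero    irr = sym (ℤ.+-identityˡ _)
split-<ᵇ (suc a) (suc b) irr = split-<ᵇ a b (irr ∘ cong suc)

module _ {n : ℕ} (G : Graph n) where

  -- An adjacent ordered pair is either increasing or decreasing. `edgeCount` counts the increasing
  -- ones, and exchanging the summations shows that the decreasing ones are equally many.
  handshake : sum (λ v → + deg G v) ≡ + edgeCount G + + edgeCount G
  handshake = trans (sum-cong-≗ λ i → trans (deg-sum G i) (trans (sum-cong-≗ (pointwise i)) (∑-distrib-+ (less i) _)))
    (trans (∑-distrib-+ (λ i → sum (less i)) (λ i → sum (λ j → less j i)))
      (cong₂ _+_ count (trans (∑-comm (λ i j → less j i)) count)))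
    where
    less : Fin n → Fin n → ℤ
    less i j = ⟦ (toℕ i <ᵇ toℕ j) ∧ adj G i j ⟧

    pointwise : ∀ i j → ⟦ adj G i j ⟧ ≡ less i j + less j i
    pointwise i j rewrite adj-sym G j i = split-<ᵇ (toℕ i) (toℕ j)
      (λ i≡j → subst (λ k → adj G i k ≡ false) (Fin.toℕ-injective i≡j) (adj-irr G i))

    count : sum (λ i → sum (less i)) ≡ + edgeCount G
    count = sym (trans (Vec-sum≡sum (λ i → ∣ row i ∣)) (sum-cong-≗ λ i → trans (∣∣-sum (row i))
      (sum-cong-≗ λ j → cong ⟦_⟧ (lookup∘tabulate (λ j → (toℕ i <ᵇ toℕ j) ∧ adj G i j) j))))
      where
      row : Fin n → Subset n
      row i = tabulate (λ j → (toℕ i <ᵇ toℕ j) ∧ adj G i j)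

  leaves : Subset n
  leaves = tabulate (λ v → deg G v ≡ᵇ 1)

  ∈leaves⇒deg≡1 : ∀ {v} → v ∈ leaves → deg G v ≡ 1
  ∈leaves⇒deg≡1 {v} v∈ = ℕ.≡ᵇ⇒≡ _ _ (from T-≡ (trans (sym (lookup∘tabulate (λ v → deg G v ≡ᵇ 1) v)) ([]=⇒lookup v∈)))

  pendent-sum : + pendent G ≡ sum (λ v → ⟦ deg G v ≡ᵇ 1 ⟧)
  pendent-sum = trans (∣∣-sum leaves) (sum-cong-≗ λ v → cong ⟦_⟧ (lookup∘tabulate (λ v → deg G v ≡ᵇ 1) v))

  adj⇒1≤deg : ∀ {u v} → Adj G u v → 1ℤ ≤ + deg G u
  adj⇒1≤deg uv = length-≤-deg G ([] ∷ []) (uv ∷ [])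

  leaf-neighbour-unique : ∀ {x a b} → deg G x ≡ 1 → Adj G x a → Adj G x b → a ≡ b
  leaf-neighbour-unique {a = a} {b} d≡1 xa xb with a ≟ b
  ... | yes a≡b = a≡b
  ... | no a≢b with s≤s () ← subst (2 ℕ.≤_) d≡1
    (ℤ.drop‿+≤+ (length-≤-deg G ((a≢b ∷ []) ∷ [] ∷ []) (xa ∷ xb ∷ [])))

unicyclic⇒1≤deg : ∀ {n} (G : Graph n) → Unicyclic G → ∀ v → 1ℤ ≤ + deg G v
-- A single vertex carries no edge, so the edge count cannot be 1.
unicyclic⇒1≤deg {1} G (_ , ()) v
unicyclic⇒1≤deg {suc (suc n)} G ((_ , reach) , _) v = step (other v)
  where
  other : ∀ v → ∃[ w ] w ≢ v
  other zero    = suc zero , λ ()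
  other (suc v) = zero , λ ()

  step : ∃[ w ] w ≢ v → 1ℤ ≤ + deg G v
  step (w , w≢v) with reach v w
  ... | here _       = contradiction refl w≢v
  ... | there _ vu _ = adj⇒1≤deg G vu

-- The potential of the whole graph

module _ {n : ℕ} (G : Graph n) (C : Subset n) where
  open Potential G C

  -- Its sum over all vertices is the quantity m of the opening comment.
  excess : Fin n → ℤ
  excess v = if lookup C v then + deg G v - + 2 else 0ℤ

  -- Termwise, charge + 2 · excess + 2 = deg + 2 · [deg = 1]. The constants 2 add up to 2n, and so
  -- do the degrees by `handshake` and `e≡n`, so the two cancel.
  potential-⊤ : edgeCount G ≡ n → (∀ v → 1ℤ ≤ + deg G v) → (∀ v → v ∈ C → + 2 ≤ + deg G v) →
    potential ⊤ + (sum excess + sum excess) ≡ + pendent G + + pendent G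
  potential-⊤ e≡n 1≤deg 2≤deg = cancel (potential ⊤) (sum excess) (+ n) (+ pendent G)
    (trans (sym sumˡ) (trans (sum-cong-≗ pointwise) sumʳ))
    where
    leaf : Fin n → ℤ
    leaf v = ⟦ deg G v ≡ᵇ 1 ⟧

    sumˡ : sum (λ v → charge ⊤ v + (excess v + excess v) + (1ℤ + 1ℤ))
           ≡ potential ⊤ + (sum excess + sum excess) + (+ n + + n)
    sumˡ = trans (∑-distrib-+ (λ v → charge ⊤ v + (excess v + excess v)) (λ _ → 1ℤ + 1ℤ))
      (cong₂ _+_
        (trans (∑-distrib-+ (charge ⊤) (λ v → excess v + excess v))
               (cong (λ s → potential ⊤ + s) (∑-distrib-+ excess excess)))
        (trans (∑-distrib-+ {n} (λ _ → 1ℤ) (λ _ → 1ℤ)) (cong₂ _+_ (sum-one n) (sum-one n))))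

    sumʳ : sum (λ v → + deg G v + (leaf v + leaf v)) ≡ + n + + n + (+ pendent G + + pendent G)
    sumʳ = trans (∑-distrib-+ (λ v → + deg G v) (λ v → leaf v + leaf v))
      (cong₂ _+_ (trans (handshake G) (cong (λ e → + e + + e) e≡n))
                 (trans (∑-distrib-+ leaf leaf) (cong₂ _+_ (sym (pendent-sum G)) (sym (pendent-sum G)))))

    cancel : ∀ p m n l → p + (m + m) + (n + n) ≡ n + n + (l + l) → p + (m + m) ≡ l + l
    cancel p m n l eq = ∙-cancelʳ (n + n) _ _ (trans eq (ℤ.+-comm (n + n) (l + l)))

    outside : ∀ d → 1ℤ ≤ + d → + defect d + 0ℤ + (1ℤ + 1ℤ) ≡ + d + (⟦ d ≡ᵇ 1 ⟧ + ⟦ d ≡ᵇ 1 ⟧)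
    outside 0             (+≤+ ())
    outside 1             _ = refl
    outside (suc (suc d)) _ = cong +_ (trans (cong (ℕ._+ 2) (ℕ.+-identityʳ d))
      (trans (ℕ.+-comm d 2) (sym (ℕ.+-identityʳ _))))

    inside : ∀ d → + 2 ≤ + d →
      + 2 - + d + (+ d - + 2 + (+ d - + 2)) + (1ℤ + 1ℤ) ≡ + d + (⟦ d ≡ᵇ 1 ⟧ + ⟦ d ≡ᵇ 1 ⟧)
    inside 0             (+≤+ ())
    inside 1             (+≤+ (s≤s ()))
    inside (suc (suc d)) _ = eq (+ suc (suc d))
      where
      eq : ∀ z → + 2 - z + (z - + 2 + (z - + 2)) + (1ℤ + 1ℤ) ≡ z + 0ℤ
      eq = solve-∀

    pointwise : ∀ v → charge ⊤ v + (excess v + excess v) + (1ℤ + 1ℤ) ≡ + deg G v + (leaf v + leaf v)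
    pointwise v rewrite lookup-replicate v true | degIn-⊤ G v with lookup C v in v∈C
    ... | true  = inside (deg G v) (2≤deg v (lookup⇒[]= v C v∈C))
    ... | false = outside (deg G v) (1≤deg v)

-- Cyclic successor and predecessor

next : ∀ {k} → Fin (suc k) → Fin (suc k)
next i with view i
... | ‵fromℕ     = zero
... | ‵inject₁ j = suc j

prev : ∀ {k} → Fin (suc k) → Fin (suc k)
prev zero    = fromℕ _
prev (suc i) = inject₁ i

next-prev : ∀ {k} (i : Fin (suc k)) → next (prev i) ≡ i
next-prev {k} zero rewrite view-fromℕ k = refl
next-prev (suc i) rewrite view-inject₁ i = refl

prev-next : ∀ {k} (i : Fin (suc k)) → prev (next i) ≡ i
prev-next i with view i
... | ‵fromℕ     = refl
... | ‵inject₁ j = refl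

-- Links `next`, defined by cases on the last index, with the remainder in `SunEdge`.
toℕ-next : ∀ {k} (i : Fin (suc k)) → toℕ (next i) ≡ suc (toℕ i) % suc k
toℕ-next {k} i with view i
... | ‵fromℕ     rewrite Fin.toℕ-fromℕ k = sym (n%n≡0 (suc k))
... | ‵inject₁ j rewrite Fin.toℕ-inject₁ j = sym (m<n⇒m%n≡m (s≤s (Fin.toℕ<n j)))

-- Length at least 3 is essential: on two indices successor and predecessor coincide.
next≢prev : ∀ {k} (i : Fin (3 ℕ.+ k)) → next i ≢ prev i
next≢prev zero ()
next≢prev (suc i) eq with view i
... | ‵fromℕ with () ← eq
... | ‵inject₁ j with () ← ℕ.<⇒≢ (ℕ.m≤n⇒m≤1+n (ℕ.n<1+n (toℕ j)))
       (trans (sym (trans (Fin.toℕ-inject₁ (inject₁ j)) (Fin.toℕ-inject₁ j))) (sym (cong toℕ eq)))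

does-true : ∀ {A : Set} (a? : Dec A) → does a? ≡ true → A
does-true (yes a) _ = a

-- Degrees and potential of a partial sun

module Sun {n : ℕ} (G : Graph n) {T : Subset n} (P : PartialSun G T) where
  open PartialSun P

  onCycle? : ∀ v → Dec (∃[ i ] cyc i ≡ v)
  onCycle? v = Fin.any? (λ i → cyc i ≟ v)

  cycle : Subset n
  cycle = tabulate (λ v → does (onCycle? v))

  cyc∈cycle : ∀ i → cyc i ∈ cycle
  cyc∈cycle i = lookup⇒[]= (cyc i) cycle
    (trans (lookup∘tabulate (does ∘ onCycle?) (cyc i)) (dec-true (onCycle? (cyc i)) (i , refl)))

  ∈cycle⇒cyc : ∀ {v} → v ∈ cycle → ∃[ i ] cyc i ≡ v
  ∈cycle⇒cyc {v} v∈ = does-true (onCycle? v)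
    (trans (sym (lookup∘tabulate (does ∘ onCycle?) v)) ([]=⇒lookup v∈))

  cyc∈T : ∀ i → cyc i ∈ T
  cyc∈T i = from (vertices (cyc i)) (inj₁ (i , refl))

  leaf∈T : ∀ {i} → i ∈ U → leaf i ∈ T
  leaf∈T i∈U = from (vertices _) (inj₂ (_ , i∈U , refl))

  cycle⊆T : cycle ⊆ T
  cycle⊆T v∈ with i , refl ← ∈cycle⇒cyc v∈ = cyc∈T i

  leaf∉cycle : ∀ {i} → i ∈ U → leaf i ∉ cycle
  leaf∉cycle i∈U leaf∈ with j , eq ← ∈cycle⇒cyc leaf∈ = leaf-new _ j i∈U (sym eq)

  adj-next : ∀ i → Adj G (cyc i) (cyc (next i))
  adj-next i = from (edges _ _ (cyc∈T i) (cyc∈T (next i)))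
    (inj₁ (i , next i , toℕ-next i , inj₁ (refl , refl)))

  adj-prev : ∀ i → Adj G (cyc i) (cyc (prev i))
  adj-prev i = from (edges _ _ (cyc∈T i) (cyc∈T (prev i)))
    (inj₁ (prev i , i , trans (cong toℕ (sym (next-prev i))) (toℕ-next (prev i)) , inj₂ (refl , refl)))

  adj-leaf : ∀ {i} → i ∈ U → Adj G (cyc i) (leaf i)
  adj-leaf i∈U = from (edges _ _ (cyc∈T _) (leaf∈T i∈U)) (inj₂ (_ , i∈U , inj₁ (refl , refl)))

  next≢self : ∀ i → next i ≢ i
  next≢self i eq with () ← trans (sym (adj-irr G (cyc i)))
    (subst (λ j → Adj G (cyc i) (cyc j)) eq (adj-next i))

  cyc-next≢cyc-prev : ∀ i → cyc (next i) ≢ cyc (prev i)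
  cyc-next≢cyc-prev i eq = next≢prev i (cyc-inj _ _ eq)

  2≤deg-cyc : ∀ i → + 2 ≤ + deg G (cyc i)
  2≤deg-cyc i = length-≤-deg G ((cyc-next≢cyc-prev i ∷ []) ∷ [] ∷ []) (adj-next i ∷ adj-prev i ∷ [])

  -- Besides `w`, the vertex has its two neighbours on the cycle, and `w` differs from both.
  3≤deg-cyc : ∀ i w → w ∉ cycle → Adj G (cyc i) w → + 3 ≤ + deg G (cyc i)
  3≤deg-cyc i w w∉ iw =
    length-≤-deg G ((w≢cyc ∷ w≢cyc ∷ []) ∷ (cyc-next≢cyc-prev i ∷ []) ∷ [] ∷ [])
      (iw ∷ adj-next i ∷ adj-prev i ∷ [])
    where
    w≢cyc : ∀ {j} → w ≢ cyc j
    w≢cyc refl = w∉ (cyc∈cycle _)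

  2≤deg-∈cycle : ∀ v → v ∈ cycle → + 2 ≤ + deg G v
  2≤deg-∈cycle v v∈ with i , refl ← ∈cycle⇒cyc v∈ = 2≤deg-cyc i

  next-unique : ∀ (i j : Fin (3 ℕ.+ k)) → toℕ j ≡ suc (toℕ i) % (3 ℕ.+ k) → j ≡ next i
  next-unique i j eq = Fin.toℕ-injective (trans eq (sym (toℕ-next i)))

  cyc-neighbours : ∀ i w → w ∈ T → Adj G (cyc i) w →
    (w ≡ cyc (next i) ⊎ w ≡ cyc (prev i)) ⊎ (i ∈ U × w ≡ leaf i)
  cyc-neighbours i w w∈T iw with to (edges _ _ (cyc∈T i) w∈T) iw
  ... | inj₁ (a , b , b≡a+1 , inj₁ (a≡i , refl)) with refl ← cyc-inj _ _ a≡i = inj₁ (inj₁ (cong cyc (next-unique a b b≡a+1)))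
  ... | inj₁ (a , b , b≡a+1 , inj₂ (refl , b≡i)) with refl ← cyc-inj _ _ b≡i =
    inj₁ (inj₂ (cong cyc (sym (trans (cong prev (next-unique a b b≡a+1)) (prev-next a)))))
  ... | inj₂ (a , a∈U , inj₁ (a≡i , refl)) with refl ← cyc-inj _ _ a≡i = inj₂ (a∈U , refl)
  ... | inj₂ (a , a∈U , inj₂ (_ , leaf≡cyc)) = contradiction leaf≡cyc (leaf-new a i a∈U)

  leaf-neighbours : ∀ {i} → i ∈ U → ∀ w → w ∈ T → Adj G (leaf i) w → w ∈ₗ cyc i ∷ []
  leaf-neighbours {i} i∈U w w∈T iw with to (edges _ _ (leaf∈T i∈U) w∈T) iw
  ... | inj₁ (a , _ , _ , inj₁ (a≡leaf , _)) = contradiction (sym a≡leaf) (leaf-new i a i∈U)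
  ... | inj₁ (_ , b , _ , inj₂ (_ , b≡leaf)) = contradiction (sym b≡leaf) (leaf-new i b i∈U)
  ... | inj₂ (a , _ , inj₁ (a≡leaf , _))     = contradiction (sym a≡leaf) (leaf-new i a i∈U)
  ... | inj₂ (a , a∈U , inj₂ (refl , eq))    = here (cong cyc (leaf-inj a i a∈U i∈U eq))

  degIn-cyc-≤ : ∀ i → + degIn G T (cyc i) ≤ + 2 + ⟦ lookup U i ⟧
  degIn-cyc-≤ i with lookup U i in i∈U
  ... | true = degIn-≤-length G (cyc (next i) ∷ cyc (prev i) ∷ leaf i ∷ []) nbr
    where
    nbr : ∀ w → w ∈ T → Adj G (cyc i) w → w ∈ₗ cyc (next i) ∷ cyc (prev i) ∷ leaf i ∷ []
    nbr w w∈T iw with cyc-neighbours i w w∈T iw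
    ... | inj₁ (inj₁ eq) = here eq
    ... | inj₁ (inj₂ eq) = there (here eq)
    ... | inj₂ (_ , eq)  = there (there (here eq))
  ... | false = degIn-≤-length G (cyc (next i) ∷ cyc (prev i) ∷ []) nbr
    where
    nbr : ∀ w → w ∈ T → Adj G (cyc i) w → w ∈ₗ cyc (next i) ∷ cyc (prev i) ∷ []
    nbr w w∈T iw with cyc-neighbours i w w∈T iw
    ... | inj₁ (inj₁ eq)   = here eq
    ... | inj₁ (inj₂ eq)   = there (here eq)
    ... | inj₂ (i∈U′ , _) with () ← trans (sym i∈U) ([]=⇒lookup i∈U′)

  spread-cyc : ∀ i → spread cyc U (cyc i) ≡ ⟦ lookup U i ⟧
  spread-cyc i = spread-hit cyc U i (λ j _ → cyc-inj i j)

  module _ where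
    open Potential G cycle

    -- Discharging: a leaf of the sun has degree at most 1 in `T` and charge at least 1, while a
    -- cycle vertex has charge at least -1 if it bears a leaf and at least 0 otherwise. Hence
    -- potential + ∣ U ∣ is at least ∣ U ∣.
    0≤potential : 0ℤ ≤ potential T
    0≤potential = ≤-by-difference
      (ℤ.i≤j⇒0≤j-i (subst₂ _≤_ (sum-spread leaf U)
        (trans (∑-distrib-+ (charge T) (spread cyc U)) (cong (λ s → potential T + s) (sum-spread cyc U)))
        (sum-mono pointwise)))
      (eq (potential T) (+ ∣ U ∣))
      where
      eq : ∀ p u → p - 0ℤ ≡ p + u - u
      eq = solve-∀

      on-cycle : ∀ d b → d ≤ + 2 + b → 0ℤ ≤ + 2 - d + b
      on-cycle d b d≤ = ≤-by-difference (ℤ.i≤j⇒0≤j-i d≤) (eq′ d b)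
        where
        eq′ : ∀ d b → + 2 - d + b - 0ℤ ≡ + 2 + b - d
        eq′ = solve-∀

      on-leaf : ∀ d → + d ≤ 1ℤ → 1ℤ ≤ + defect d + 0ℤ
      on-leaf 0 _ = +≤+ (s≤s z≤n)
      on-leaf 1 _ = +≤+ (s≤s z≤n)
      on-leaf (suc (suc d)) (+≤+ (s≤s ()))

      pointwise : ∀ v → spread leaf U v ≤ charge T v + spread cyc U v
      pointwise v with v Subset.∈? T
      ... | no v∉T
        rewrite ∉⇒lookup v∉T
              | spread-miss leaf U {v} (λ i i∈U eq → v∉T (subst (_∈ T) (sym eq) (leaf∈T i∈U)))
              | spread-miss cyc U {v} (λ i _ eq → v∉T (subst (_∈ T) (sym eq) (cyc∈T i))) = ℤ.≤-refl
      ... | yes v∈T with to (vertices v) v∈T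
      ...   | inj₁ (i , refl)
        rewrite []=⇒lookup v∈T | []=⇒lookup (cyc∈cycle i) | spread-cyc i
              | spread-miss leaf U {cyc i} (λ j j∈U eq → leaf-new j i j∈U (sym eq)) =
        on-cycle _ _ (degIn-cyc-≤ i)
      ...   | inj₂ (i , i∈U , refl)
        rewrite []=⇒lookup v∈T | ∉⇒lookup (leaf∉cycle i∈U)
              | spread-miss cyc U {leaf i} (λ j _ → leaf-new i j i∈U)
              | spread-hit leaf U i (λ j j∈U → leaf-inj i j i∈U j∈U)
              | []=⇒lookup i∈U =
        on-leaf _ (degIn-≤-length G (cyc i ∷ []) (leaf-neighbours i∈U))

  excess-cyc : ∀ i → excess G cycle (cyc i) ≡ + deg G (cyc i) - + 2
  excess-cyc i rewrite []=⇒lookup (cyc∈cycle i) = refl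

  3≤deg⇒1≤excess : ∀ {i} → + 3 ≤ + deg G (cyc i) → 1ℤ ≤ excess G cycle (cyc i)
  3≤deg⇒1≤excess {i} 3≤d rewrite excess-cyc i = ℤ.+-monoˡ-≤ (- + 2) 3≤d

  0≤excess : ∀ v → 0ℤ ≤ excess G cycle v
  0≤excess v with lookup cycle v in v∈
  ... | true  = ℤ.i≤j⇒0≤j-i (2≤deg-∈cycle v (lookup⇒[]= v cycle v∈))
  ... | false = ℤ.≤-refl

  -- A cycle vertex bearing a leaf has degree at least 3, so it contributes at least 1; no
  -- contribution is negative.
  ∣U∣≤excess : + ∣ U ∣ ≤ sum (excess G cycle)
  ∣U∣≤excess = subst (_≤ sum (excess G cycle)) (sum-spread cyc U) (sum-mono pointwise)
    where
    pointwise : ∀ v → spread cyc U v ≤ excess G cycle v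
    pointwise v with v Subset.∈? cycle
    ... | no v∉ rewrite spread-miss cyc U {v} (λ i _ eq → v∉ (subst (_∈ cycle) (sym eq) (cyc∈cycle i))) = 0≤excess v
    ... | yes v∈ with i , refl ← ∈cycle⇒cyc v∈ rewrite spread-cyc i with lookup U i in i∈U
    ...   | false = 0≤excess (cyc i)
    ...   | true  = 3≤deg⇒1≤excess (3≤deg-cyc i (leaf i) (leaf∉cycle i∈U′) (adj-leaf i∈U′))
      where i∈U′ = lookup⇒[]= i U i∈U

-- Shortest walks and general position

module _ {n : ℕ} (G : Graph n) where

  reach⇒walk : ∀ {S u v} → Reach G S u v → Walk G u v
  reach⇒walk (here _)      = [ _ ]
  reach⇒walk (there _ e r) = cons _ e (reach⇒walk r)

  _++_ : ∀ {u v w} → Walk G u v → Walk G v w → Walk G u w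
  [ _ ]       ++ W′ = W′
  cons u e W ++ W′ = cons u e (W ++ W′)

  walkLength-++ : ∀ {u v w} (W : Walk G u v) (W′ : Walk G v w) →
    walkLength G (W ++ W′) ≡ walkLength G W ℕ.+ walkLength G W′
  walkLength-++ [ _ ]        W′ = refl
  walkLength-++ (cons u e W) W′ = cong suc (walkLength-++ W W′)

  -- Only the lengths of the two pieces are recorded, which is what a comparison with a shortest
  -- walk uses.
  splitWalk : ∀ {u v x} (W : Walk G u v) → x ∈ₗ walkVertices G W →
    ∃[ A ] ∃[ B ] walkLength G {u} {x} A ℕ.+ walkLength G {x} {v} B ≡ walkLength G W
  splitWalk [ v ]        (here refl) = [ v ] , [ v ] , refl
  splitWalk (cons u e W) (here refl) = [ u ] , cons u e W , refl
  splitWalk (cons u e W) (there x∈W) =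
    let A , B , eq = splitWalk W x∈W in cons u e A , B , cong suc eq

  head∈walk : ∀ {u v} (W : Walk G u v) → u ∈ₗ walkVertices G W
  head∈walk [ _ ]        = here refl
  head∈walk (cons _ _ _) = here refl

  -- Takes the first vertex inside `C` and its predecessor. The edge is read from inside to outside,
  -- as in `walk-leaves`, so that one gate hypothesis serves both.
  walk-enters : ∀ C {u v} (W : Walk G u v) → u ∉ C → v ∈ C →
    ∃[ c ] ∃[ w ] (c ∈ₗ walkVertices G W × c ∈ C × w ∉ C × Adj G c w)
  walk-enters C [ _ ] u∉C u∈C = contradiction u∈C u∉C
  walk-enters C (cons {w} u e W) u∉C v∈C with w Subset.∈? C
  ... | yes w∈C = w , u , there (head∈walk W) , w∈C , u∉C , trans (adj-sym G w u) e
  ... | no w∉C =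
    let c , x , c∈W , rest = walk-enters C W w∉C v∈C in c , x , there c∈W , rest

  walk-leaves : ∀ C {u v} (W : Walk G u v) → u ∈ C → v ∉ C →
    ∃[ c ] ∃[ w ] (c ∈ₗ walkVertices G W × c ∈ C × w ∉ C × Adj G c w)
  walk-leaves C [ _ ] u∈C u∉C = contradiction u∈C u∉C
  walk-leaves C (cons {w} u e W) u∈C v∉C with w Subset.∈? C
  ... | no w∉C = u , w , here refl , u∈C , w∉C , e
  ... | yes w∈C =
    let c , x , c∈W , rest = walk-leaves C W w∈C v∉C in c , x , there c∈W , rest

  shortest-tail : ∀ {u w v} {e : Adj G u w} {W : Walk G w v} → IsShortest G (cons u e W) → IsShortest G W
  shortest-tail {u} {e = e} shortest W′ = ℕ.s≤s⁻¹ (shortest (cons u e W′))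

  -- A leaf in the interior would be entered and left through its only neighbour, and cutting out
  -- this excursion shortens the walk by 2.
  leaf-is-end : ∀ {u v x} (W : Walk G u v) → IsShortest G W → deg G x ≡ 1 →
    x ∈ₗ walkVertices G W → x ≡ u ⊎ x ≡ v
  leaf-is-end [ _ ]        _ _ (here x≡u) = inj₁ x≡u
  leaf-is-end (cons _ _ _) _ _ (here x≡u) = inj₁ x≡u
  leaf-is-end (cons u e W) shortest d≡1 (there x∈W)
    with leaf-is-end W (shortest-tail {e = e} {W} shortest) d≡1 x∈W
  ... | inj₂ x≡v  = inj₂ x≡v
  ... | inj₁ refl with W
  ...   | [ _ ] = inj₂ refl
  ...   | cons x e′ W′ with refl ← leaf-neighbour-unique G d≡1 (trans (adj-sym G x u) e) e′ =
    contradiction (shortest W′) (ℕ.<⇒≱ (ℕ.m≤n⇒m≤1+n (ℕ.n<1+n _)))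

  -- W passes v₀ both before and after z, so the part in between can be cut out.
  no-detour : ∀ C {u v v₀ z} (W : Walk G u v) → IsShortest G W → u ∉ C → v ∉ C →
    (∀ c w → c ∈ C → w ∉ C → Adj G c w → c ≡ v₀) → z ∈ C → z ∈ₗ walkVertices G W → z ≡ v₀
  no-detour C {u} {v} {v₀} {z} W shortest u∉C v∉C gate z∈C z∈W
    with A , B , eqW ← splitWalk W z∈W
    with a , w , a∈A , a∈C , w∉C , aw ← walk-enters C A u∉C z∈C
       | b , x , b∈B , b∈C , x∉C , bx ← walk-leaves C B z∈C v∉C
    with refl ← gate a w a∈C w∉C aw | refl ← gate b x b∈C x∉C bx
    with A₁ , A₂ , eqA ← splitWalk A a∈A | B₁ , B₂ , eqB ← splitWalk B b∈B
    with A₂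
  ... | [ _ ] = refl
  ... | cons _ _ A₂′ = contradiction (shortest (A₁ ++ B₂)) (ℕ.<⇒≱ shorter)
    where
    open ℕ.≤-Reasoning
    shorter : walkLength G (A₁ ++ B₂) ℕ.< walkLength G W
    shorter = begin-strict
      walkLength G (A₁ ++ B₂)                     ≡⟨ walkLength-++ A₁ B₂ ⟩
      walkLength G A₁ ℕ.+ walkLength G B₂         <⟨ ℕ.+-mono-<-≤ (ℕ.m<m+n (walkLength G A₁) (s≤s z≤n)) (ℕ.m≤n+m (walkLength G B₂) (walkLength G B₁)) ⟩
      walkLength G A₁ ℕ.+ suc (walkLength G A₂′) ℕ.+ (walkLength G B₁ ℕ.+ walkLength G B₂)
                                                  ≡⟨ cong₂ ℕ._+_ eqA eqB ⟩
      walkLength G A ℕ.+ walkLength G B           ≡⟨ eqW ⟩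
      walkLength G W                              ∎

  -- By `leaf-is-end` both leaves are ends, and being distinct they occupy both ends, so there is no
  -- room for a third leaf.
  ends-are-leaves : ∀ {u v x y} (W : Walk G u v) → IsShortest G W →
    x ∈ leaves G → y ∈ leaves G → x ≢ y → x ∈ₗ walkVertices G W → y ∈ₗ walkVertices G W →
    u ∈ leaves G × v ∈ leaves G
    × (∀ z → z ∈ leaves G → z ∈ₗ walkVertices G W → z ≡ x ⊎ z ≡ y)
  ends-are-leaves W shortest x∈L y∈L x≢y x∈W y∈W
    with leaf-is-end W shortest (∈leaves⇒deg≡1 G x∈L) x∈W | leaf-is-end W shortest (∈leaves⇒deg≡1 G y∈L) y∈W
  ... | inj₁ refl | inj₁ refl = contradiction refl x≢y
  ... | inj₂ refl | inj₂ refl = contradiction refl x≢y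
  ... | inj₁ refl | inj₂ refl = x∈L , y∈L , λ z z∈L → leaf-is-end W shortest (∈leaves⇒deg≡1 G z∈L)
  ... | inj₂ refl | inj₁ refl = y∈L , x∈L , λ z z∈L z∈W → swap (leaf-is-end W shortest (∈leaves⇒deg≡1 G z∈L) z∈W)

  leaves-generalPosition : GeneralPosition G (leaves G)
  leaves-generalPosition x y z x∈L y∈L z∈L x≢y y≢z x≢z (u , v , W , shortest , x∈W , y∈W , z∈W)
    with _ , _ , only ← ends-are-leaves W shortest x∈L y∈L x≢y x∈W y∈W
    with only z z∈L z∈W
  ... | inj₁ z≡x = x≢z (sym z≡x)
  ... | inj₂ z≡y = y≢z (sym z≡y)

  -- Two leaves on a shortest walk are its ends, and these lie off `C`. By `no-detour` the walk
  -- meets `C` at most in the gate `v₀`, so it misses `c`.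
  leaves+-generalPosition : ∀ C {v₀ c} → (∀ {v} → v ∈ leaves G → v ∉ C) →
    (∀ c w → c ∈ C → w ∉ C → Adj G c w → c ≡ v₀) → c ∈ C → c ≢ v₀ →
    GeneralPosition G (leaves G ∪ ⁅ c ⁆)
  leaves+-generalPosition C {v₀} {c} L∩C=∅ gate c∈C c≢v₀ = go
    where
    apart : ∀ {u v x y} (W : Walk G u v) → IsShortest G W → x ∈ leaves G → y ∈ leaves G → x ≢ y →
      x ∈ₗ walkVertices G W → y ∈ₗ walkVertices G W → ¬ c ∈ₗ walkVertices G W
    apart W shortest x∈L y∈L x≢y x∈W y∈W c∈W
      with u∈L , v∈L , _ ← ends-are-leaves W shortest x∈L y∈L x≢y x∈W y∈W =
      c≢v₀ (no-detour C W shortest (L∩C=∅ u∈L) (L∩C=∅ v∈L) gate c∈C c∈W)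

    member : ∀ {v} → v ∈ leaves G ∪ ⁅ c ⁆ → v ∈ leaves G ⊎ v ≡ c
    member v∈ with Subset.x∈p∪q⁻ (leaves G) ⁅ c ⁆ v∈
    ... | inj₁ v∈L = inj₁ v∈L
    ... | inj₂ v∈c = inj₂ (Subset.x∈⁅y⁆⇒x≡y c v∈c)

    go : GeneralPosition G (leaves G ∪ ⁅ c ⁆)
    go x y z x∈ y∈ z∈ x≢y y≢z x≢z common@(u , v , W , shortest , x∈W , y∈W , z∈W)
      with member x∈ | member y∈ | member z∈
    ... | inj₁ x∈L  | inj₁ y∈L  | inj₁ z∈L  = leaves-generalPosition x y z x∈L y∈L z∈L x≢y y≢z x≢z common
    ... | inj₁ x∈L  | inj₁ y∈L  | inj₂ refl = apart W shortest x∈L y∈L x≢y x∈W y∈W z∈W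
    ... | inj₁ x∈L  | inj₂ refl | inj₁ z∈L  = apart W shortest x∈L z∈L x≢z x∈W z∈W y∈W
    ... | inj₂ refl | inj₁ y∈L  | inj₁ z∈L  = apart W shortest y∈L z∈L y≢z y∈W z∈W x∈W
    ... | inj₂ refl | inj₂ refl | _         = x≢y refl
    ... | inj₂ refl | inj₁ _    | inj₂ refl = x≢z refl
    ... | inj₁ _    | inj₂ refl | inj₂ refl = y≢z refl

  pair-generalPosition : ∀ a b → GeneralPosition G (⁅ a ⁆ ∪ ⁅ b ⁆)
  pair-generalPosition a b x y z x∈ y∈ z∈ x≢y y≢z x≢z _ with member x∈ | member y∈ | member z∈
    where
    member : ∀ {v} → v ∈ ⁅ a ⁆ ∪ ⁅ b ⁆ → v ≡ a ⊎ v ≡ b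
    member v∈ with Subset.x∈p∪q⁻ ⁅ a ⁆ ⁅ b ⁆ v∈
    ... | inj₁ v∈a = inj₁ (Subset.x∈⁅y⁆⇒x≡y a v∈a)
    ... | inj₂ v∈b = inj₂ (Subset.x∈⁅y⁆⇒x≡y b v∈b)
  ... | inj₁ refl | inj₁ refl | _         = x≢y refl
  ... | inj₂ refl | inj₂ refl | _         = x≢y refl
  ... | inj₁ refl | inj₂ refl | inj₁ refl = x≢z refl
  ... | inj₁ refl | inj₂ refl | inj₂ refl = y≢z refl
  ... | inj₂ refl | inj₁ refl | inj₁ refl = y≢z refl
  ... | inj₂ refl | inj₁ refl | inj₂ refl = x≢z refl

-- Lower bounds for the general position number

∣p∣<∣p∪⁅x⁆∣ : ∀ {n} (p : Subset n) {x} → x ∉ p → ∣ p ∣ ℕ.< ∣ p ∪ ⁅ x ⁆ ∣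
∣p∣<∣p∪⁅x⁆∣ p {x} x∉p =
  Subset.p⊂q⇒∣p∣<∣q∣ (Subset.p⊆p∪q ⁅ x ⁆ , x , Subset.q⊆p∪q p ⁅ x ⁆ (Subset.x∈⁅x⁆ x) , x∉p)

module _ {n : ℕ} (G : Graph n) {T : Subset n} (P : PartialSun G T) (unicyclic : Unicyclic G) where
  open PartialSun P
  open Sun G P

  leaf-∉cycle : ∀ {v} → v ∈ leaves G → v ∉ cycle
  leaf-∉cycle v∈L v∈ with s≤s () ← subst (2 ℕ.≤_) (∈leaves⇒deg≡1 G v∈L) (ℤ.drop‿+≤+ (2≤deg-∈cycle _ v∈))

  gp-≥ : ∀ {g} → IsGpNumber G g → + 2 + + pendent G ≤ + g + sum (excess G cycle)
  gp-≥ {g} (_ , bound) with Fin.any? (λ i → 3 ℕ.≤? deg G (cyc i))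
  ... | no none = ℤ.+-mono-≤ {+ 2} {+ g} {+ pendent G} 2≤g (ℤ.≤-trans (ℤ.≤-reflexive (cong +_ noLeaves)) 0≤m)
    where
    0≤m : 0ℤ ≤ sum (excess G cycle)
    0≤m = ℤ.≤-trans (+≤+ z≤n) ∣U∣≤excess

    2≤g : + 2 ≤ + g
    2≤g = +≤+ (ℕ.≤-trans
      (subst (ℕ._< ∣ ⁅ cyc zero ⁆ ∪ ⁅ cyc (suc zero) ⁆ ∣) (Subset.∣⁅x⁆∣≡1 (cyc zero))
        (∣p∣<∣p∪⁅x⁆∣ ⁅ cyc zero ⁆ (Subset.x≢y⇒x∉⁅y⁆ (λ eq → Fin.0≢1+n (sym (cyc-inj _ _ eq))))))
      (bound _ (pair-generalPosition G (cyc zero) (cyc (suc zero)))))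

    -- A walk from a leaf of `G` to the cycle would enter it at a cycle vertex of degree at least 3,
    -- and `none` excludes these.
    noLeaves : pendent G ≡ 0
    noLeaves = trans (cong ∣_∣ (Subset.Empty-unique {p = leaves G} empty)) (Subset.∣⊥∣≡0 n)
      where
      empty : Subset.Empty (leaves G)
      empty (v , v∈L)
        with c , w , _ , c∈ , w∉ , cw ← walk-enters G cycle
               (reach⇒walk G (proj₂ (proj₁ unicyclic) v (cyc zero))) (leaf-∉cycle v∈L) (cyc∈cycle zero)
        with i , refl ← ∈cycle⇒cyc c∈ = none (i , ℤ.drop‿+≤+ (3≤deg-cyc i w w∉ cw))
  ... | yes (i , 3≤di) with Fin.any? (λ j → ¬? (i ≟ j) ×-dec (3 ℕ.≤? deg G (cyc j)))
  -- The leaves alone form the general position set; the 2 comes from the excess of two cycle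
  -- vertices, at least 1 each.
  ...   | yes (j , i≢j , 3≤dj) = subst (_≤ + g + sum (excess G cycle)) (ℤ.+-comm (+ pendent G) (+ 2))
    (ℤ.+-mono-≤ (+≤+ (bound _ (leaves-generalPosition G)))
      (length-≤-sum (((i≢j ∘ cyc-inj _ _) ∷ []) ∷ [] ∷ []) 0≤excess
        (3≤deg⇒1≤excess (+≤+ 3≤di) ∷ 3≤deg⇒1≤excess (+≤+ 3≤dj) ∷ [])))
  -- Here the 2 splits: one unit is the extra vertex `cyc (next i)` in the general position set, the
  -- other is the excess of the gate `cyc i`.
  ...   | no noOther = subst (_≤ + g + sum (excess G cycle)) (ℤ.+-comm (+ suc (pendent G)) 1ℤ)
    (ℤ.+-mono-≤ (+≤+ (ℕ.≤-trans (∣p∣<∣p∪⁅x⁆∣ (leaves G) (λ z∈L → leaf-∉cycle z∈L (cyc∈cycle (next i))))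
        (bound _ (leaves+-generalPosition G cycle leaf-∉cycle gate (cyc∈cycle (next i)) (next≢self i ∘ cyc-inj _ _)))))
      (length-≤-sum ([] ∷ []) 0≤excess (3≤deg⇒1≤excess (+≤+ 3≤di) ∷ [])))
    where
    gate : ∀ c w → c ∈ cycle → w ∉ cycle → Adj G c w → c ≡ cyc i
    gate c w c∈ w∉ cw with j , refl ← ∈cycle⇒cyc c∈ with i ≟ j
    ... | yes i≡j = cong cyc (sym i≡j)
    ... | no i≢j  = contradiction (j , i≢j , ℤ.drop‿+≤+ (3≤deg-cyc j w w∉ cw)) noOther

-- Combining the potential bounds

trim-bound : ∀ {n} (G : Graph n) → Unicyclic G → ∀ {T n₁ n₂ n₃} → Trim G ⊤ T n₁ n₂ n₃ →
  ∀ C → C ⊆ T → (∀ v → v ∈ C → + 2 ≤ + deg G v) → 0ℤ ≤ Potential.potential G C T →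
  + n₂ - + n₁ ≤ + pendent G - sum (excess G C)
-- All potential estimates count with factor 2, so twice the inequality is proved and the factor
-- cancelled; `potential-⊤` replaces the initial potential by 2ℓ - 2m.
trim-bound G unicyclic {T} {n₁} {n₂} t C C⊆T 2≤deg 0≤pot = ℤ.*-cancelˡ-≤-pos _ _ (+ 2) (≤-by-difference
  (0≤+ 0≤pot (ℤ.i≤j⇒0≤j-i (potential-trim C⊆T t)))
  (eq (potential T) (potential ⊤) (sum (excess G C)) (+ pendent G) (+ n₁) (+ n₂)
    (potential-⊤ G C (proj₂ unicyclic) (unicyclic⇒1≤deg G unicyclic) 2≤deg)))
  where
  open Potential G C
  eq : ∀ pT p m l a b → p + (m + m) ≡ l + l →
    + 2 * (l - m) - + 2 * (b - a) ≡ pT + (p + (a + a) - (pT + (b + b)))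
  eq pT p m l a b h = trans (ring₁ l m a b) (trans (cong (λ s → s - (m + m) - (b + b) + (a + a)) (sym h)) (ring₂ pT p m a b))
    where
    ring₁ : ∀ l m a b → + 2 * (l - m) - + 2 * (b - a) ≡ l + l - (m + m) - (b + b) + (a + a)
    ring₁ = solve-∀
    ring₂ : ∀ pT p m a b → p + (m + m) - (m + m) - (b + b) + (a + a) ≡ pT + (p + (a + a) - (pT + (b + b)))
    ring₂ = solve-∀

theorem2p3 : ∀ {n} (G : Graph n) → Unicyclic G →
    ∀ {T : Subset n} {n₁ n₂ n₃ : ℕ} → Trim G ⊤ T n₁ n₂ n₃ → Stuck G T →
    (∀ (P : PartialSun G T) (g : ℕ) → IsGpNumber G g →
    + (2 ⊔ ∣ PartialSun.U P ∣) + + n₂ - + n₁ ≤ + g)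
    × (T ≡ ⊥ → + n₂ - + n₁ ≤ + pendent G)
theorem2p3 {n} G unicyclic {T} {n₁} {n₂} t _ = sun , empty
  where
  sun : ∀ (P : PartialSun G T) (g : ℕ) → IsGpNumber G g →
        + (2 ⊔ ∣ PartialSun.U P ∣) + + n₂ - + n₁ ≤ + g
  -- Adding n₂ - n₁ ≤ ℓ - m to max {2, ∣ U ∣} + ℓ ≤ gp + m eliminates both ℓ and m.
  sun P g isGp = ≤-by-difference
    (0≤+ (ℤ.i≤j⇒0≤j-i (trim-bound G unicyclic t cycle cycle⊆T 2≤deg-∈cycle 0≤potential))
         (ℤ.i≤j⇒0≤j-i max+pendent≤))
    (eq (+ g) (+ (2 ⊔ ∣ U ∣)) (+ n₁) (+ n₂) (+ pendent G) (sum (excess G cycle)))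
    where
    open PartialSun P
    open Sun G P

    max+pendent≤ : + (2 ⊔ ∣ U ∣) + + pendent G ≤ + g + sum (excess G cycle)
    max+pendent≤ with ℕ.⊔-sel 2 ∣ U ∣
    ... | inj₁ eq rewrite eq = gp-≥ G P unicyclic isGp
    -- If the maximum is `∣ U ∣`, the total excess covers it and the leaves supply ℓ.
    ... | inj₂ eq rewrite eq = subst (_≤ + g + sum (excess G cycle)) (ℤ.+-comm (+ pendent G) (+ ∣ U ∣))
      (ℤ.+-mono-≤ (+≤+ (proj₂ isGp _ (leaves-generalPosition G))) ∣U∣≤excess)

    eq : ∀ g u a b l m → g - (u + b - a) ≡ l - m - (b - a) + (g + m - (u + l))
    eq = solve-∀

  empty : T ≡ ⊥ → + n₂ - + n₁ ≤ + pendent G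
  -- With an empty cycle both the excess and the final potential vanish.
  empty refl = subst (+ n₂ - + n₁ ≤_)
    (trans (cong (λ s → + pendent G - s) noExcess) (ℤ.+-identityʳ (+ pendent G)))
    (trim-bound G unicyclic t ⊥ (λ v∈⊥ → v∈⊥) (λ v v∈⊥ → contradiction v∈⊥ Subset.∉⊥)
      (ℤ.≤-reflexive (sym noPotential)))
    where
    open Potential G ⊥

    noExcess : sum (excess G ⊥) ≡ 0ℤ
    noExcess = trans (sum-cong-≗ pointwise) (sum-zero n)
      where
      pointwise : ∀ v → excess G ⊥ v ≡ 0ℤ
      pointwise v rewrite lookup-replicate {n = n} v false = refl

    noPotential : potential ⊥ ≡ 0ℤ
    noPotential = trans (sum-cong-≗ pointwise) (sum-zero n)
      where
      pointwise : ∀ v → charge ⊥ v ≡ 0ℤ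
      pointwise v rewrite lookup-replicate {n = n} v false = refl
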